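{- (ZF, without the Axiom of Choice.) For each cardinal $\kappa\in On$ and each $\mu\in On$ there is a cardinal $\lambda\in On$ such that $\lambda\to(\kappa)^2_\mu$.
   Context: The base theory is ZF. Cardinals are initial ordinals. $\lambda\to(\kappa)^2_\mu$ means: for every function $c:[\lambda]^2\to\mu$ there is a set $H\subset\lambda$ of cardinality $\kappa$ such that $c$ is constant on $[H]^2$. -}

module Defs where

open import Level using (Level) renaming (suc to lsuc)
open import Data.Nat using (ℕ; suc)
open import Data.Fin using (Fin)
open import Data.Vec using (Vec; _∷_; lookup)
open import Data.Product using (Σ-syntax; ∃-syntax; _×_)
open import Data.Sum using (_⊎_)
open import Function.Bundles using (_⇔_)
open import Relation.Nullary using (¬_; Dec)
open import Relation.Binary.PropositionalEquality using (_≡_; _≢_)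

-- First-order formulas over {∈, =} with free variables in Fin n (de Bruijn
-- indices).  They are needed because separation and replacement are schemata
-- over formulas; quantifying over all Agda predicates instead would give a
-- second-order theory.

infix  7 _∈'_ _≡'_
infixr 6 _∧'_
infixr 5 _∨'_
infixr 4 _⇒'_
infix  3 _⇔'_

data Formula (n : ℕ) : Set where
  _∈'_ _≡'_                : Fin n → Fin n → Formula n
  ¬'_                      : Formula n → Formula n
  _∧'_ _∨'_ _⇒'_ _⇔'_      : Formula n → Formula n → Formula n
  ∀'_ ∃'_                  : Formula (suc n) → Formula n

record Structure (ℓ : Level) : Set (lsuc ℓ) where
  infix 4 _∈_
  field
    Carrier : Set ℓ
    _∈_     : Carrier → Carrier → Set ℓ

module Satisfaction {ℓ : Level} (𝔐 : Structure ℓ) where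
  open Structure 𝔐

  infix 2 _⊨_
  _⊨_ : ∀ {n} → Vec Carrier n → Formula n → Set ℓ
  ρ ⊨ i ∈' j = lookup ρ i ∈ lookup ρ j
  ρ ⊨ i ≡' j = lookup ρ i ≡ lookup ρ j
  ρ ⊨ ¬' φ   = ¬ (ρ ⊨ φ)
  ρ ⊨ φ ∧' ψ = (ρ ⊨ φ) × (ρ ⊨ ψ)
  ρ ⊨ φ ∨' ψ = (ρ ⊨ φ) ⊎ (ρ ⊨ ψ)
  ρ ⊨ φ ⇒' ψ = (ρ ⊨ φ) → (ρ ⊨ ψ)
  ρ ⊨ φ ⇔' ψ = (ρ ⊨ φ) ⇔ (ρ ⊨ ψ)
  ρ ⊨ ∀' φ   = ∀ x → x ∷ ρ ⊨ φ
  ρ ⊨ ∃' φ   = ∃[ x ] (x ∷ ρ ⊨ φ)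

  -- ZF is a theory in classical logic: excluded middle is required for
  -- first-order formulas about the structure, not for arbitrary Agda types.
  Classical : Set ℓ
  Classical = ∀ {n} (φ : Formula n) (ρ : Vec Carrier n) → Dec (ρ ⊨ φ)

-- The set-theoretic notions are spelled out relationally, as first-order
-- properties of ∈ and =, so each is the satisfaction of a formula.

module SetTheory {ℓ : Level} (𝔐 : Structure ℓ) where
  open Structure 𝔐 public

  private V = Carrier

  infix 4 _⊆_ _≐∅ _≐[_,_] _≐⟨_,_⟩ _≐suc_ ⟨_,_⟩∈_ _∈[_]² _≃_

  _⊆_ : V → V → Set ℓ
  x ⊆ y = ∀ z → z ∈ x → z ∈ y

  _≐∅ : V → Set ℓ
  x ≐∅ = ∀ z → ¬ (z ∈ x)

  _≐[_,_] : V → V → V → Set ℓ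
  p ≐[ a , b ] = ∀ z → z ∈ p ⇔ (z ≡ a ⊎ z ≡ b)

  -- Kuratowski: p = {{a},{a,b}}.
  _≐⟨_,_⟩ : V → V → V → Set ℓ
  p ≐⟨ a , b ⟩ = ∃[ s ] ∃[ d ] s ≐[ a , a ] × d ≐[ a , b ] × p ≐[ s , d ]

  -- y = x ∪ {x}.
  _≐suc_ : V → V → Set ℓ
  y ≐suc x = ∀ z → z ∈ y ⇔ (z ∈ x ⊎ z ≡ x)

  ⟨_,_⟩∈_ : V → V → V → Set ℓ
  ⟨ x , y ⟩∈ f = ∃[ p ] p ≐⟨ x , y ⟩ × p ∈ f

  -- p is a two-element subset of X.
  _∈[_]² : V → V → Set ℓ
  p ∈[ X ]² = ∃[ a ] ∃[ b ] a ∈ X × b ∈ X × a ≢ b × p ≐[ a , b ]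

  -- The set f is the graph of a function A → B.  A and B are given by their
  -- membership predicates so that [X]² can serve as a domain.
  Function : V → (V → Set ℓ) → (V → Set ℓ) → Set ℓ
  Function f A B =
      (∀ p → p ∈ f → ∃[ x ] ∃[ y ] A x × B y × p ≐⟨ x , y ⟩)
    × (∀ x → A x → ∃[ y ] ⟨ x , y ⟩∈ f)
    × (∀ x y y′ → ⟨ x , y ⟩∈ f → ⟨ x , y′ ⟩∈ f → y ≡ y′)

  Bijection : V → V → V → Set ℓ
  Bijection f X Y =
      Function f (_∈ X) (_∈ Y)
    × (∀ x x′ y → ⟨ x , y ⟩∈ f → ⟨ x′ , y ⟩∈ f → x ≡ x′)
    × (∀ y → y ∈ Y → ∃[ x ] ⟨ x , y ⟩∈ f)

  _≃_ : V → V → Set ℓ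
  X ≃ Y = ∃[ f ] Bijection f X Y

  Transitive : V → Set ℓ
  Transitive x = ∀ y → y ∈ x → y ⊆ x

  WellOrderedBy∈ : V → Set ℓ
  WellOrderedBy∈ α =
      (∀ x → x ∈ α → ¬ (x ∈ x))
    × (∀ x y z → x ∈ α → y ∈ α → z ∈ α → x ∈ y → y ∈ z → x ∈ z)
    × (∀ x y → x ∈ α → y ∈ α → x ∈ y ⊎ x ≡ y ⊎ y ∈ x)
    × (∀ S → S ⊆ α → (∃[ x ] x ∈ S) →
         ∃[ m ] m ∈ S × (∀ x → x ∈ S → m ≡ x ⊎ m ∈ x))

  Ordinal : V → Set ℓ
  Ordinal α = Transitive α × WellOrderedBy∈ α

  -- Initial ordinals; finite ones are included.
  Cardinal : V → Set ℓ
  Cardinal κ = Ordinal κ × (∀ α → α ∈ κ → ¬ (α ≃ κ))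

  ConstantOn[_]² : V → V → Set ℓ
  ConstantOn[ H ]² c =
    ∀ p q u v → p ∈[ H ]² → q ∈[ H ]² → ⟨ p , u ⟩∈ c → ⟨ q , v ⟩∈ c → u ≡ v

  -- Colourings and homogeneous sets range over elements of the structure.
  _⟶⟨_⟩²_ : V → V → V → Set ℓ
  θ ⟶⟨ κ ⟩² μ =
    ∀ c → Function c (_∈[ θ ]²) (_∈ μ) →
      ∃[ H ] H ⊆ θ × H ≃ κ × ConstantOn[ H ]² c

record ZF {ℓ : Level} (𝔐 : Structure ℓ) : Set ℓ where
  open SetTheory 𝔐
  open Satisfaction 𝔐
  field
    extensionality : ∀ x y → (∀ z → z ∈ x ⇔ z ∈ y) → x ≡ y
    foundation     : ∀ x → (∃[ z ] z ∈ x) →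
                     ∃[ y ] y ∈ x × (∀ z → z ∈ x → ¬ (z ∈ y))
    pairing        : ∀ a b → ∃[ p ] p ≐[ a , b ]
    union          : ∀ x → ∃[ u ] (∀ z → z ∈ u ⇔ (∃[ y ] y ∈ x × z ∈ y))
    powerset       : ∀ x → ∃[ P ] (∀ z → z ∈ P ⇔ z ⊆ x)
    infinity       : ∃[ w ] (∃[ e ] e ≐∅ × e ∈ w)
                          × (∀ x → x ∈ w → ∃[ y ] y ≐suc x × y ∈ w)
    separation     : ∀ {n} (φ : Formula (suc n)) (ρ : Vec Carrier n) x →
                     ∃[ y ] (∀ z → z ∈ y ⇔ (z ∈ x × (z ∷ ρ ⊨ φ)))
    replacement    : ∀ {n} (φ : Formula (suc (suc n))) (ρ : Vec Carrier n) x →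
                     (∀ u v v′ → u ∈ x → (u ∷ v ∷ ρ ⊨ φ) → (u ∷ v′ ∷ ρ ⊨ φ) →
                        v ≡ v′) →
                     ∃[ y ] (∀ v → v ∈ y ⇔ (∃[ u ] u ∈ x × (u ∷ v ∷ ρ ⊨ φ)))

{-# OPTIONS --safe #-}
module Submission where

-- Order θ by the Erdős–Rado tree: β ◁ α when β ∈ α and c(γ , β) = c(γ , α) for
-- all γ ◁ β.  Predecessors of a point α that receive the same colour i with α
-- form a homogeneous set, well-ordered by ∈.  If one of these sets has order
-- type at least κ, the first such has order type exactly κ.  Otherwise every
-- γ ◁ α is located by its colour i and its rank, an element of κ, among the
-- predecessors of colour i; coding the points of a branch by subsets of κ × μ
-- then embeds θ in P(P(κ × μ) × μ), which is impossible if θ is the Hartogs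
-- number of that set.

open import Level using (Level)
open import Data.Nat using (ℕ; suc; _+_)
open import Data.Fin using (Fin; zero; suc; _↑ʳ_; punchIn)
open import Data.Fin.Patterns using (0F; 1F; 2F; 3F; 4F; 5F; 6F)
open import Data.Vec using (Vec; []; _∷_; lookup)
open import Data.Product using (∃-syntax; _×_; _,_; proj₁; proj₂)
open import Data.Sum using (_⊎_; inj₁; inj₂; swap; map; map₂) renaming ([_,_]′ to [_,_])
open import Data.Empty using (⊥-elim)
open import Function.Base using (_∘_; id)
open import Function.Bundles using (_⇔_; mk⇔; Equivalence)
open import Function.Construct.Symmetry using (⇔-sym)
open import Relation.Nullary using (¬_; Dec; yes; no)
open import Relation.Nullary.Decidable using (decidable-stable)
open import Relation.Binary.PropositionalEquality
  using (_≡_; refl; sym; trans; subst)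
open import Defs
open Equivalence using (to; from)

-- Formulas for the notions of SetTheory; satisfaction of each unfolds
-- definitionally to the notion it is named after.

private variable
  n m : ℕ

infix 7 _≐[_,_]' _≐⟨_,_⟩' ⟨_,_⟩∈'_

_≐[_,_]' _≐⟨_,_⟩' ⟨_,_⟩∈'_ : Fin n → Fin n → Fin n → Formula n
p ≐[ a , b ]' = ∀' (0F ∈' suc p ⇔' (0F ≡' suc a ∨' 0F ≡' suc b))
p ≐⟨ a , b ⟩' = ∃' ∃' (1F ≐[ suc (suc a) , suc (suc a) ]'
                      ∧' 0F ≐[ suc (suc a) , suc (suc b) ]'
                      ∧' suc (suc p) ≐[ 1F , 0F ]')
⟨ x , y ⟩∈' f = ∃' (0F ≐⟨ suc x , suc y ⟩' ∧' 0F ∈' suc f)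

Transitive' Comparable' IsOrdinal' : Fin n → Formula n
Transitive' x = ∀' (0F ∈' suc x ⇒' (∀' (0F ∈' 1F ⇒' 0F ∈' suc (suc x))))
Comparable' α = ∀' ∀' (1F ∈' suc (suc α) ⇒' 0F ∈' suc (suc α) ⇒'
                       (1F ∈' 0F ∨' 1F ≡' 0F ∨' 0F ∈' 1F))
IsOrdinal' α = Transitive' α
            ∧' (∀' (0F ∈' suc α ⇒' Transitive' 0F))
            ∧' Comparable' α

Embedding' : Fin n → Fin n → Fin n → Formula n
Embedding' h v Y =
     (∀' (0F ∈' suc v ⇒' (∃' (0F ∈' suc (suc Y) ∧' ⟨ 1F , 0F ⟩∈' suc (suc h)))))
  ∧' (∀' ∀' ∀' (⟨ 2F , 0F ⟩∈' suc (suc (suc h)) ⇒'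
                ⟨ 1F , 0F ⟩∈' suc (suc (suc h)) ⇒' 2F ≡' 1F))

Image' : Fin n → Fin n → Fin n → Fin n → Formula n
Image' z h a Y = ∀' (0F ∈' suc z ⇔'
  (0F ∈' suc Y ∧' (∃' (0F ∈' suc (suc a) ∧' ⟨ 0F , 1F ⟩∈' suc (suc h)))))

Coded' : Fin n → Fin n → Fin n → Formula n
Coded' u v Y = IsOrdinal' v ∧' (∃' (Embedding' 0F (suc v) (suc Y) ∧'
  (∀' (0F ∈' suc (suc u) ⇔'
       (∃' (0F ∈' suc (suc (suc v)) ∧' Image' 1F 2F 0F (suc (suc (suc Y)))))))))

Col' : Fin n → Fin n → Fin n → Fin n → Formula n
Col' c γ α i = ∃' (0F ≐[ suc γ , suc α ]' ∧' ⟨ 0F , suc i ⟩∈' suc c)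

Agree' : Fin n → Fin n → Fin n → Fin n → Formula n
Agree' c γ β α = ∃' (Col' (suc c) (suc γ) (suc β) 0F ∧' Col' (suc c) (suc γ) (suc α) 0F)

Rank' : Fin n → Fin n → Fin n → Fin n → Formula n
Rank' S γ i ξ = ∀' (0F ∈' suc ξ ⇔'
  (∃' (0F ≐⟨ 1F , suc (suc i) ⟩' ∧' ⟨ suc (suc γ) , 0F ⟩∈' suc (suc S))))

Same' : Fin n → Fin n → Fin n → Formula n
Same' S γ γ′ = ∀' (⟨ suc γ , 0F ⟩∈' suc S ⇔' ⟨ suc γ′ , 0F ⟩∈' suc S)

Sub' : Fin n → Fin n → Fin n → Fin n → Fin n → Formula n
Sub' c T S α α′ = ∀' ∀' (⟨ suc (suc α) , 1F ⟩∈' suc (suc T) ⇒'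
  Col' (suc (suc c)) 1F (suc (suc α)) 0F ⇒'
  (∃' (⟨ suc (suc (suc α′)) , 0F ⟩∈' suc (suc (suc T))
       ∧' Col' (suc (suc (suc c))) 0F (suc (suc (suc α′))) 1F
       ∧' Same' (suc (suc (suc S))) 2F 0F)))

-- Renaming the variables of a formula.

lift : (Fin n → Fin m) → Fin (suc n) → Fin (suc m)
lift r zero    = zero
lift r (suc i) = suc (r i)

rename : (Fin n → Fin m) → Formula n → Formula m
rename r (i ∈' j) = r i ∈' r j
rename r (i ≡' j) = r i ≡' r j
rename r (¬' φ)   = ¬' rename r φ
rename r (φ ∧' ψ) = rename r φ ∧' rename r ψ
rename r (φ ∨' ψ) = rename r φ ∨' rename r ψ
rename r (φ ⇒' ψ) = rename r φ ⇒' rename r ψ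
rename r (φ ⇔' ψ) = rename r φ ⇔' rename r ψ
rename r (∀' φ)   = ∀' rename (lift r) φ
rename r (∃' φ)   = ∃' rename (lift r) φ

extend₃ : Fin m → Fin m → Fin m → (Fin n → Fin m) → Fin (3 + n) → Fin m
extend₃ a b c r zero                = a
extend₃ a b c r (suc zero)          = b
extend₃ a b c r (suc (suc zero))    = c
extend₃ a b c r (suc (suc (suc i))) = r i

module _ {ℓ : Level} (𝔐 : Structure ℓ) where
  open SetTheory 𝔐
  open Satisfaction 𝔐

  Along : (Fin n → Fin m) → Vec Carrier n → Vec Carrier m → Set ℓ
  Along r ρ σ = ∀ i → lookup σ (r i) ≡ lookup ρ i

  lift-along : {r : Fin n → Fin m} {ρ : Vec Carrier n} {σ : Vec Carrier m} →
               Along r ρ σ → ∀ x → Along (lift r) (x ∷ ρ) (x ∷ σ)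
  lift-along e x zero    = refl
  lift-along e x (suc i) = e i

  -- Needed where a formula is a parameter, in `comprehension` and `Recursion`: there satisfaction
  -- does not unfold by computation.
  ⊨-rename : (φ : Formula n) {r : Fin n → Fin m} {ρ : Vec Carrier n} {σ : Vec Carrier m} →
             Along r ρ σ → (σ ⊨ rename r φ) ⇔ (ρ ⊨ φ)
  ⊨-rename (i ∈' j) e rewrite e i | e j = mk⇔ id id
  ⊨-rename (i ≡' j) e rewrite e i | e j = mk⇔ id id
  ⊨-rename (¬' φ) e = mk⇔ (_∘ from (⊨-rename φ e)) (_∘ to (⊨-rename φ e))
  ⊨-rename (φ ∧' ψ) e =
    mk⇔ (λ (a , b) → to (⊨-rename φ e) a , to (⊨-rename ψ e) b)
        (λ (a , b) → from (⊨-rename φ e) a , from (⊨-rename ψ e) b)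
  ⊨-rename (φ ∨' ψ) e =
    mk⇔ [ inj₁ ∘ to (⊨-rename φ e) , inj₂ ∘ to (⊨-rename ψ e) ]
        [ inj₁ ∘ from (⊨-rename φ e) , inj₂ ∘ from (⊨-rename ψ e) ]
  ⊨-rename (φ ⇒' ψ) e =
    mk⇔ (λ f → to (⊨-rename ψ e) ∘ f ∘ from (⊨-rename φ e))
        (λ f → from (⊨-rename ψ e) ∘ f ∘ to (⊨-rename φ e))
  ⊨-rename (φ ⇔' ψ) e =
    mk⇔ (λ f → mk⇔ (to (⊨-rename ψ e) ∘ to f ∘ from (⊨-rename φ e))
                   (to (⊨-rename φ e) ∘ from f ∘ from (⊨-rename ψ e)))
        (λ f → mk⇔ (from (⊨-rename ψ e) ∘ to f ∘ to (⊨-rename φ e))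
                   (from (⊨-rename φ e) ∘ from f ∘ to (⊨-rename ψ e)))
  ⊨-rename (∀' φ) e =
    mk⇔ (λ f x → to (⊨-rename φ (lift-along e x)) (f x))
        (λ f x → from (⊨-rename φ (lift-along e x)) (f x))
  ⊨-rename (∃' φ) e =
    mk⇔ (λ (x , a) → x , to (⊨-rename φ (lift-along e x)) a)
        (λ (x , a) → x , from (⊨-rename φ (lift-along e x)) a)

module Development {ℓ : Level} (𝔐 : Structure ℓ)
                   (classical : Satisfaction.Classical 𝔐) (zf : ZF 𝔐) where
  open SetTheory 𝔐
  open Satisfaction 𝔐
  open ZF zf

  private
    V = Carrier

  -- Well-founded induction for definable properties

  ∈-irrefl : ∀ x → ¬ (x ∈ x)
  ∈-irrefl x x∈x with pairing x x
  ... | p , p≐ with foundation p (x , from (p≐ x) (inj₁ refl))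
  ...   | y , y∈p , min with to (p≐ y) y∈p
  ...     | inj₁ refl = min x (from (p≐ x) (inj₁ refl)) x∈x
  ...     | inj₂ refl = min x (from (p≐ x) (inj₁ refl)) x∈x

  least : (φ : Formula (suc n)) (ρ : Vec V n) (X : V) →
          ∃[ x ] (x ∈ X × (x ∷ ρ ⊨ φ)) →
          ∃[ m ] m ∈ X × (m ∷ ρ ⊨ φ) × (∀ z → z ∈ X → (z ∷ ρ ⊨ φ) → ¬ (z ∈ m))
  least φ ρ X (x , x∈X , φx) =
    let S , S≐ = separation φ ρ X
        m , m∈S , min = foundation S (x , from (S≐ x) (x∈X , φx))
        m∈X , φm = to (S≐ m) m∈S
    in m , m∈X , φm , λ z z∈X φz → min z (from (S≐ z) (z∈X , φz))

  -- A minimal counterexample contradicts `step`. It comes from the set of counterexamples in `X`,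
  -- which separation provides only for a formula; hence the explicit formula at each use.
  ∈-induction : (φ : Formula (suc n)) (ρ : Vec V n) (X : V) →
                (∀ x → x ∈ X → (∀ y → y ∈ X → y ∈ x → y ∷ ρ ⊨ φ) → x ∷ ρ ⊨ φ) →
                ∀ x → x ∈ X → x ∷ ρ ⊨ φ
  ∈-induction φ ρ X step x x∈X = decidable-stable (classical φ (x ∷ ρ)) λ ¬φx →
    let m , m∈X , ¬φm , min = least (¬' φ) ρ X (x , x∈X , ¬φx)
    in ¬φm (step m m∈X λ y y∈X y∈m → decidable-stable (classical φ (y ∷ ρ))
         λ ¬φy → min y y∈X ¬φy y∈m)

  -- Pairs and relations

  ≐[]-unique : ∀ {p q a b} → p ≐[ a , b ] → q ≐[ a , b ] → p ≡ q
  ≐[]-unique p≐ q≐ = extensionality _ _ λ z → mk⇔ (from (q≐ z) ∘ to (p≐ z)) (from (p≐ z) ∘ to (q≐ z))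

  ≐[]-comm : ∀ {p a b} → p ≐[ a , b ] → p ≐[ b , a ]
  ≐[]-comm p≐ z = mk⇔ (swap ∘ to (p≐ z)) (from (p≐ z) ∘ swap)

  ≐[]-injective : ∀ {p a b a′ b′} → p ≐[ a , b ] → p ≐[ a′ , b′ ] →
                  (a ≡ a′ × b ≡ b′) ⊎ (a ≡ b′ × b ≡ a′)
  ≐[]-injective {a = a} {b} {a′} {b′} p≐ p≐′
    with to (p≐′ a) (from (p≐ a) (inj₁ refl)) | to (p≐′ b) (from (p≐ b) (inj₂ refl))
       | to (p≐ a′) (from (p≐′ a′) (inj₁ refl)) | to (p≐ b′) (from (p≐′ b′) (inj₂ refl))
  ... | inj₁ refl | inj₂ refl | _ | _ = inj₁ (refl , refl)
  ... | inj₂ refl | inj₁ refl | _ | _ = inj₂ (refl , refl)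
  ... | inj₁ refl | inj₁ refl | _ | inj₁ refl = inj₁ (refl , refl)
  ... | inj₁ refl | inj₁ refl | _ | inj₂ refl = inj₁ (refl , refl)
  ... | inj₂ refl | inj₂ refl | inj₁ refl | _ = inj₁ (refl , refl)
  ... | inj₂ refl | inj₂ refl | inj₂ refl | _ = inj₁ (refl , refl)

  ≐⟨⟩-unique : ∀ {p q a b} → p ≐⟨ a , b ⟩ → q ≐⟨ a , b ⟩ → p ≡ q
  ≐⟨⟩-unique (s , d , s≐ , d≐ , p≐) (s′ , d′ , s′≐ , d′≐ , q≐)
    with refl ← ≐[]-unique s≐ s′≐ | refl ← ≐[]-unique d≐ d′≐ = ≐[]-unique p≐ q≐

  ≐⟨⟩-injective : ∀ {p a b a′ b′} → p ≐⟨ a , b ⟩ → p ≐⟨ a′ , b′ ⟩ → a ≡ a′ × b ≡ b′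
  ≐⟨⟩-injective (s , d , s≐ , d≐ , p≐) (s′ , d′ , s′≐ , d′≐ , p≐′)
    with ≐[]-injective p≐ p≐′
  ... | inj₁ (refl , refl) with ≐[]-injective s≐ s′≐ | ≐[]-injective d≐ d′≐
  ...   | inj₁ (refl , _) | inj₁ (_ , refl) = refl , refl
  ...   | inj₁ (refl , _) | inj₂ (refl , refl) = refl , refl
  ...   | inj₂ (refl , _) | inj₁ (_ , refl) = refl , refl
  ...   | inj₂ (refl , _) | inj₂ (refl , refl) = refl , refl
  ≐⟨⟩-injective (s , d , s≐ , d≐ , p≐) (s′ , d′ , s′≐ , d′≐ , p≐′)
      | inj₂ (refl , refl) with ≐[]-injective s≐ d′≐ | ≐[]-injective d≐ s′≐
  ...   | inj₁ (refl , refl) | inj₁ (_ , refl) = refl , refl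
  ...   | inj₁ (refl , refl) | inj₂ (_ , refl) = refl , refl
  ...   | inj₂ (refl , refl) | inj₁ (_ , refl) = refl , refl
  ...   | inj₂ (refl , refl) | inj₂ (_ , refl) = refl , refl

  ordered-pair : ∀ a b → ∃[ p ] p ≐⟨ a , b ⟩
  ordered-pair a b =
    let s , s≐ = pairing a a
        d , d≐ = pairing a b
        p , p≐ = pairing s d
    in p , s , d , s≐ , d≐ , p≐

  abstract
    -- For x ∈ X and y ∈ Y both {x} and {x, y} are subsets of U = X ∪ Y, so the pair lies in
    -- P(P(U)), from which the product is separated.
    product : ∀ X Y → ∃[ P ] (∀ p → p ∈ P ⇔ (∃[ x ] ∃[ y ] x ∈ X × y ∈ Y × p ≐⟨ x , y ⟩))
    product X Y =
      let t , t≐ = pairing X Y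
          U , U≐ = union t
          PU , PU≐ = powerset U
          PPU , PPU≐ = powerset PU
          P , P≐ = separation (∃' ∃' (1F ∈' 3F ∧' 0F ∈' 4F ∧' 2F ≐⟨ 1F , 0F ⟩')) (X ∷ Y ∷ []) PPU
          X⊆U = λ x (x∈X : x ∈ X) → from (U≐ x) (X , from (t≐ X) (inj₁ refl) , x∈X)
          Y⊆U = λ y (y∈Y : y ∈ Y) → from (U≐ y) (Y , from (t≐ Y) (inj₂ refl) , y∈Y)
          bound : ∀ p → ∃[ x ] ∃[ y ] x ∈ X × y ∈ Y × p ≐⟨ x , y ⟩ → p ∈ PPU
          bound = λ { p (x , y , x∈X , y∈Y , s , d , s≐ , d≐ , p≐) →
            from (PPU≐ p) λ q q∈p → from (PU≐ q) λ z z∈q →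
              [ (λ { refl → [ (λ { refl → X⊆U x x∈X }) , (λ { refl → X⊆U x x∈X }) ] (to (s≐ z) z∈q) })
              , (λ { refl → [ (λ { refl → X⊆U x x∈X }) , (λ { refl → Y⊆U y y∈Y }) ] (to (d≐ z) z∈q) })
              ] (to (p≐ q) q∈p) }
      in P , λ p → mk⇔ (proj₂ ∘ to (P≐ p)) (λ e → from (P≐ p) (bound p e , e))

  -- The second component makes D a set of pairs; φ is read in the context y ∷ x ∷ ρ.
  abstract
    comprehension : (φ : Formula (2 + n)) (ρ : Vec V n) (X Y : V) →
      ∃[ D ] (∀ p → p ∈ D → ∃[ x ] ∃[ y ] x ∈ X × y ∈ Y × p ≐⟨ x , y ⟩)
           × (∀ x y → ⟨ x , y ⟩∈ D ⇔ (x ∈ X × y ∈ Y × (y ∷ x ∷ ρ ⊨ φ)))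
    comprehension {n} φ ρ X Y =
      let P , P≐ = product X Y
          -- The context is `y ∷ x ∷ p ∷ ρ`; `punchIn 2F` makes `φ` skip the pair `p`.
          D , D≐ = separation (∃' ∃' (2F ≐⟨ 1F , 0F ⟩' ∧' rename (punchIn 2F) φ)) ρ P
      in D , (λ p → to (P≐ p) ∘ proj₁ ∘ to (D≐ p)) , λ x y → mk⇔
        (λ (p , p≐ , p∈D) →
           let p∈P , x′ , y′ , p≐′ , φ′ = to (D≐ p) p∈D
               x″ , y″ , x∈X , y∈Y , p≐″ = to (P≐ p) p∈P
               x″≡x , y″≡y = ≐⟨⟩-injective p≐″ p≐
               x′≡x , y′≡y = ≐⟨⟩-injective p≐′ p≐
           in subst (_∈ X) x″≡x x∈X , subst (_∈ Y) y″≡y y∈Y ,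
              subst (λ x → y ∷ x ∷ ρ ⊨ φ) x′≡x
                (subst (λ y → y ∷ x′ ∷ ρ ⊨ φ) y′≡y (to (⊨-rename 𝔐 φ skip) φ′)))
        (λ (x∈X , y∈Y , φxy) →
           let p , p≐ = ordered-pair x y in
           p , p≐ , from (D≐ p)
             (from (P≐ p) (x , y , x∈X , y∈Y , p≐) , x , y , p≐ , from (⊨-rename 𝔐 φ skip) φxy))
      where
      skip : ∀ {x y p} → Along 𝔐 (punchIn 2F) (y ∷ x ∷ ρ) (y ∷ x ∷ p ∷ ρ)
      skip zero          = refl
      skip (suc zero)    = refl
      skip (suc (suc i)) = refl

  -- Ordinals

  Comparable : V → Set ℓ
  Comparable α = ∀ x y → x ∈ α → y ∈ α → x ∈ y ⊎ x ≡ y ⊎ y ∈ x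

  -- Equivalent to `Ordinal` under foundation. It does not quantify over subsets, which keeps the
  -- formula `IsOrdinal'` short.
  IsOrdinal : V → Set ℓ
  IsOrdinal α = Transitive α × (∀ x → x ∈ α → Transitive x) × Comparable α

  Ordinal⇒IsOrdinal : ∀ {α} → Ordinal α → IsOrdinal α
  Ordinal⇒IsOrdinal (trα , _ , tr , cmp , _) =
    trα ,
    (λ z z∈α y y∈z x x∈y → let y∈α = trα z z∈α y y∈z in
       tr x y z (trα y y∈α x x∈y) y∈α z∈α x∈y y∈z) ,
    cmp

  IsOrdinal⇒Ordinal : ∀ {α} → IsOrdinal α → Ordinal α
  IsOrdinal⇒Ordinal (trα , tr , cmp) =
    trα , (λ x _ → ∈-irrefl x) , (λ x y z _ _ z∈α x∈y y∈z → tr z z∈α y y∈z x x∈y) , cmp ,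
    λ S S⊆α ne → let m , m∈S , min = foundation S ne in
      m , m∈S , λ x x∈S → [ inj₂ , [ inj₁ , (λ x∈m → ⊥-elim (min x x∈S x∈m)) ] ]
                            (cmp m x (S⊆α m m∈S) (S⊆α x x∈S))

  IsOrdinal-∈ : ∀ {α x} → IsOrdinal α → x ∈ α → IsOrdinal x
  IsOrdinal-∈ {x = x} (trα , tr , cmp) x∈α =
    tr x x∈α , (λ y y∈x → tr y (trα x x∈α y y∈x)) ,
    λ y z y∈x z∈x → cmp y z (trα x x∈α y y∈x) (trα x x∈α z z∈x)

  -- If w is not all of α, it equals the least m ∈ α outside w: elements of m lie in w by
  -- minimality, and some z ∈ w with z = m or m ∈ z would put m into w.
  transitive-subset : ∀ {α w} → IsOrdinal α → Transitive w → w ⊆ α → w ≡ α ⊎ w ∈ α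
  transitive-subset {α} {w} (trα , _ , cmp) trw w⊆α
    with classical (∃' (0F ∈' 2F ∧' (¬' (0F ∈' 1F)))) (w ∷ α ∷ [])
  ... | no ¬e = inj₁ (extensionality w α λ z → mk⇔ (w⊆α z) λ z∈α →
          decidable-stable (classical (0F ∈' 1F) (z ∷ w ∷ [])) λ z∉w → ¬e (z , z∈α , z∉w))
  ... | yes e with least (¬' (0F ∈' 1F)) (w ∷ []) α e
  ...   | m , m∈α , m∉w , min = inj₂ (subst (_∈ α) (extensionality m w λ z → mk⇔
            (λ z∈m → decidable-stable (classical (0F ∈' 1F) (z ∷ w ∷ []))
               λ z∉w → min z (trα m m∈α z z∈m) z∉w z∈m)
            (λ z∈w → [ id , [ (λ { refl → ⊥-elim (m∉w z∈w) })
                            , (λ m∈z → ⊥-elim (m∉w (trw z z∈w m m∈z))) ] ]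
                     (cmp z m (w⊆α z z∈w) m∈α))) m∈α)

  -- The intersection w of α and β is a transitive subset of both, so it equals or belongs to each;
  -- it cannot belong to both, for then w ∈ w.
  ordinals-comparable : ∀ {α β} → IsOrdinal α → IsOrdinal β → α ∈ β ⊎ α ≡ β ⊎ β ∈ α
  ordinals-comparable {α} {β} oα oβ with separation (0F ∈' 1F) (β ∷ []) α
  ... | w , w≐ = compare (transitive-subset oα trw λ z → proj₁ ∘ to (w≐ z))
                         (transitive-subset oβ trw λ z → proj₂ ∘ to (w≐ z))
    where
    trw : Transitive w
    trw y y∈w z z∈y = let y∈α , y∈β = to (w≐ y) y∈w in
      from (w≐ z) (proj₁ oα y y∈α z z∈y , proj₁ oβ y y∈β z z∈y)
    compare : w ≡ α ⊎ w ∈ α → w ≡ β ⊎ w ∈ β → α ∈ β ⊎ α ≡ β ⊎ β ∈ α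
    compare (inj₁ refl) (inj₁ refl) = inj₂ (inj₁ refl)
    compare (inj₁ refl) (inj₂ w∈β)  = inj₁ w∈β
    compare (inj₂ w∈α)  (inj₁ refl) = inj₂ (inj₂ w∈α)
    compare (inj₂ w∈α)  (inj₂ w∈β)  = ⊥-elim (∈-irrefl w (from (w≐ w) (w∈α , w∈β)))

  -- Hartogs numbers

  -- The relation need not be single-valued.
  Embedding : V → V → V → Set ℓ
  Embedding h v Y = (∀ a → a ∈ v → ∃[ y ] y ∈ Y × ⟨ a , y ⟩∈ h)
                  × (∀ a a′ y → ⟨ a , y ⟩∈ h → ⟨ a′ , y ⟩∈ h → a ≡ a′)

  _embeds-in_ : V → V → Set ℓ
  v embeds-in Y = ∃[ h ] Embedding h v Y

  -- `h′` is the converse of `f` followed by `h`; it is injective because `h` is and because `f` is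
  -- single-valued.
  embeds-≃ : ∀ {v w Y} → v ≃ w → v embeds-in Y → w embeds-in Y
  embeds-≃ {v} {w} {Y} (f , (fun , _ , single) , _ , onto) (h , total , inj) =
    h′ , (λ b b∈w →
            let a , ab = onto b b∈w
                p , p≐ , p∈f = ab
                x , y , x∈v , _ , p≐′ = fun p p∈f
                z , z∈Y , az = total a (subst (_∈ v) (proj₁ (≐⟨⟩-injective p≐′ p≐)) x∈v)
            in z , z∈Y , from (h′≐ b z) (b∈w , z∈Y , a , ab , az)) ,
         (λ b b′ z bz b′z →
            let _ , _ , a , ab , az = to (h′≐ b z) bz
                _ , _ , a′ , a′b′ , a′z = to (h′≐ b′ z) b′z
            in single a b b′ ab (subst (λ x → ⟨ x , b′ ⟩∈ f) (inj a′ a z a′z az) a′b′))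
    where
    comp = comprehension (∃' (⟨ 0F , 2F ⟩∈' 3F ∧' ⟨ 0F , 1F ⟩∈' 4F)) (f ∷ h ∷ []) w Y
    h′ = proj₁ comp
    h′≐ = proj₂ (proj₂ comp)

  module _ (Y : V) where

    Image : V → V → V → Set ℓ
    Image z h a = ∀ y → y ∈ z ⇔ (y ∈ Y × ∃[ b ] (b ∈ a × ⟨ b , y ⟩∈ h))

    -- An ordinal embedded in Y is recovered from the chain of images of its
    -- elements, so replacement applied to the chains of subsets of Y collects
    -- these ordinals.
    Coded : V → V → Set ℓ
    Coded u v = IsOrdinal v × ∃[ h ] (Embedding h v Y ×
                  (∀ z → z ∈ u ⇔ (∃[ a ] (a ∈ v × Image z h a))))

    image : ∀ h a → ∃[ z ] Image z h a
    image h a = separation (∃' (0F ∈' 3F ∧' ⟨ 0F , 1F ⟩∈' 2F)) (h ∷ a ∷ []) Y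

    -- A value of b belongs to the image of a but, by injectivity, not to that of b.
    image-strict : ∀ {h v a b z z′} → Embedding h v Y → b ∈ v → b ∈ a →
                   Image z h a → Image z′ h b → ¬ (z ⊆ z′)
    image-strict {b = b} (total , inj) b∈v b∈a z≐ z′≐ z⊆z′ =
      let y , y∈Y , by = total b b∈v
          _ , b′ , b′∈b , b′y = to (z′≐ y) (z⊆z′ y (from (z≐ y) (y∈Y , b , b∈a , by)))
      in ∈-irrefl b (subst (_∈ b) (inj b′ b y b′y by) b′∈b)

    image-mono : ∀ {h a b z z′} → Transitive b → (a ∈ b ⊎ a ≡ b) →
                 Image z h a → Image z′ h b → z ⊆ z′
    image-mono {a = a} trb a≤b z≐ z′≐ y y∈z =
      let y∈Y , c , c∈a , cy = to (z≐ y) y∈z in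
      from (z′≐ y) (y∈Y , c , [ (λ a∈b → trb a a∈b c c∈a) , (λ { refl → c∈a }) ] a≤b , cy)

    coded-functional : ∀ u v v′ → Coded u v → Coded u v′ → v ≡ v′
    coded-functional u v v′ ((trv , tr , cmp) , h , emb , u≐) ((trv′ , tr′ , cmp′) , h′ , emb′ , u≐′) =
      extensionality v v′ λ a → mk⇔
        (λ a∈v → let z , z≐ = image h a
                     a′ , a′∈v′ , z≐′ = to (u≐′ z) (from (u≐ z) (a , a∈v , z≐))
                 in subst (_∈ v′) (sym (rigid a a∈v a′ z a′∈v′ z≐ z≐′)) a′∈v′)
        (λ a′∈v′ → let z , z≐′ = image h′ a
                       a₀ , a₀∈v , z≐ = to (u≐ z) (from (u≐′ z) (a , a′∈v′ , z≐′))
                   in subst (_∈ v) (rigid a₀ a₀∈v a z a′∈v′ z≐ z≐′) a₀∈v)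
      where
      -- By ∈-induction: b ∈ a has the same image as some b′ ∈ v′, and b = b′ by induction. If b′
      -- were not in a′, the image of a′ would be contained in that of b′, against strictness. The
      -- other inclusion is symmetric.
      rigid : ∀ a → a ∈ v → ∀ a′ z → a′ ∈ v′ → Image z h a → Image z h′ a′ → a ≡ a′
      rigid = ∈-induction
        (∀' ∀' (1F ∈' 5F ⇒' Image' 0F 3F 2F 6F ⇒' Image' 0F 4F 1F 6F ⇒' 2F ≡' 1F))
        (h ∷ h′ ∷ v′ ∷ Y ∷ []) v
        λ a a∈v ih a′ z a′∈v′ z≐ z≐′ → extensionality a a′ λ b → mk⇔
          (λ b∈a →
             let b∈v = trv a a∈v b b∈a
                 w , w≐ = image h b
                 b′ , b′∈v′ , w≐′ = to (u≐′ w) (from (u≐ w) (b , b∈v , w≐))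
                 b≡b′ = ih b b∈v b∈a b′ w b′∈v′ w≐ w≐′
                 strict = image-strict emb b∈v b∈a z≐ w≐
             in subst (_∈ a′) (sym b≡b′)
                  ([ id , [ (λ e → ⊥-elim (strict (image-mono (tr′ b′ b′∈v′) (inj₂ (sym e)) z≐′ w≐′)))
                          , (λ e → ⊥-elim (strict (image-mono (tr′ b′ b′∈v′) (inj₁ e) z≐′ w≐′))) ] ]
                     (cmp′ b′ a′ b′∈v′ a′∈v′)))
          (λ b∈a′ →
             let b∈v′ = trv′ a′ a′∈v′ b b∈a′
                 w , w≐′ = image h′ b
                 b₀ , b₀∈v , w≐ = to (u≐ w) (from (u≐′ w) (b , b∈v′ , w≐′))
                 strict = image-strict emb′ b∈v′ b∈a′ z≐′ w≐′
                 b₀∈a = [ id , [ (λ e → ⊥-elim (strict (image-mono (tr b₀ b₀∈v) (inj₂ (sym e)) z≐ w≐)))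
                               , (λ e → ⊥-elim (strict (image-mono (tr b₀ b₀∈v) (inj₁ e) z≐ w≐))) ] ]
                          (cmp b₀ a b₀∈v a∈v)
             in subst (_∈ a) (ih b₀ b₀∈v b₀∈a b w b∈v′ w≐ w≐′) b₀∈a)

    embedded-ordinals : ∃[ Θ ] (∀ v → v ∈ Θ ⇔ (IsOrdinal v × v embeds-in Y))
    embedded-ordinals =
      let PY , PY≐ = powerset Y
          PPY , PPY≐ = powerset PY
          Θ , Θ≐ = replacement (Coded' 0F 1F 2F) (Y ∷ []) PPY
                     (λ u v v′ _ → coded-functional u v v′)
      in Θ , λ v → mk⇔
        (λ v∈Θ → let u , _ , ov , h , emb , _ = to (Θ≐ v) v∈Θ in ov , h , emb)
        (λ (ov , h , emb) →
           let u , u≐ = separation (∃' (0F ∈' 2F ∧' Image' 1F 3F 0F 4F)) (v ∷ h ∷ Y ∷ []) PY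
           in from (Θ≐ v) (u , from (PPY≐ u) (λ z z∈u → proj₁ (to (u≐ z) z∈u)) , ov , h , emb ,
                λ z → mk⇔ (proj₂ ∘ to (u≐ z))
                  (λ e → from (u≐ z)
                    (from (PY≐ z) (λ y y∈z → proj₁ (to (proj₂ (proj₂ e) y) y∈z)) , e))))

    abstract
      -- Θ is the set of ordinals that embed in `Y`. It is itself an ordinal, so embedding in `Y`
      -- would make it its own element; an α ∈ Θ equinumerous with Θ would hand its embedding on to
      -- Θ.
      hartogs : ∃[ Θ ] Cardinal Θ × ¬ (Θ embeds-in Y)
      hartogs with embedded-ordinals
      ... | Θ , Θ≐ = Θ , (IsOrdinal⇒Ordinal oΘ , λ α α∈Θ α≃Θ →
                        Θ⋠Y (embeds-≃ α≃Θ (proj₂ (to (Θ≐ α) α∈Θ)))) , Θ⋠Y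
        where
        oΘ : IsOrdinal Θ
        oΘ = (λ v v∈Θ w w∈v → let ov , h , total , inj = to (Θ≐ v) v∈Θ in
                from (Θ≐ w) (IsOrdinal-∈ ov w∈v , h ,
                             (λ a a∈w → total a (proj₁ ov w w∈v a a∈w)) , inj)) ,
             (λ v v∈Θ → proj₁ (proj₁ (to (Θ≐ v) v∈Θ))) ,
             λ v w v∈Θ w∈Θ → ordinals-comparable (proj₁ (to (Θ≐ v) v∈Θ)) (proj₁ (to (Θ≐ w) w∈Θ))
        Θ⋠Y : ¬ (Θ embeds-in Y)
        Θ⋠Y e = ∈-irrefl Θ (from (Θ≐ Θ) (oΘ , e))

  -- Recursive definition of a relation along its first argument

  module Recursion (φ : Formula (3 + n)) (ρ : Vec V n) (Y : V) where

    -- The recursion clause: whether y enters the section at x, given the relation `D` built so far.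
    Ψ : V → V → V → Set ℓ
    Ψ D x y = D ∷ x ∷ y ∷ ρ ⊨ φ

    Good : V → V → Set ℓ
    Good D x = ∀ z y → z ∈ x → ⟨ z , y ⟩∈ D ⇔ Ψ D z y

    Good' : Fin m → Fin m → (Fin n → Fin m) → Formula m
    Good' D x r = ∀' ∀' (1F ∈' suc (suc x) ⇒'
      (⟨ 1F , 0F ⟩∈' suc (suc D) ⇔' rename (extend₃ (suc (suc D)) 1F 0F (λ i → 2 ↑ʳ r i)) φ))

    along₃ : ∀ (σ : Vec V m) a b c (r : Fin n → Fin m) → Along 𝔐 r ρ σ →
             Along 𝔐 (extend₃ a b c r) (lookup σ a ∷ lookup σ b ∷ lookup σ c ∷ ρ) σ
    along₃ σ a b c r e zero                = refl
    along₃ σ a b c r e (suc zero)          = refl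
    along₃ σ a b c r e (suc (suc zero))    = refl
    along₃ σ a b c r e (suc (suc (suc i))) = e i

    ⊨-Ψ : ∀ (σ : Vec V m) a b c (r : Fin n → Fin m) → Along 𝔐 r ρ σ →
          (σ ⊨ rename (extend₃ a b c r) φ) ⇔ Ψ (lookup σ a) (lookup σ b) (lookup σ c)
    ⊨-Ψ σ a b c r e = ⊨-rename 𝔐 φ {σ = σ} (along₃ σ a b c r e)

    ⊨-Good : ∀ (σ : Vec V m) D x (r : Fin n → Fin m) → Along 𝔐 r ρ σ →
             (σ ⊨ Good' D x r) ⇔ Good (lookup σ D) (lookup σ x)
    ⊨-Good σ D x r e = mk⇔
      (λ g z y z∈x → mk⇔ (to (sem z y) ∘ to (g z y z∈x)) (from (g z y z∈x) ∘ from (sem z y)))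
      (λ g z y z∈x → mk⇔ (from (sem z y) ∘ to (g z y z∈x)) (from (g z y z∈x) ∘ to (sem z y)))
      where
      sem : ∀ z y → _
      sem z y = ⊨-Ψ (y ∷ z ∷ σ) (suc (suc D)) 1F 0F (λ i → 2 ↑ʳ r i) e

    AgreeBelow : V → V → V → Set ℓ
    AgreeBelow x D D′ = ∀ z y → z ∈ x → ⟨ z , y ⟩∈ D ⇔ ⟨ z , y ⟩∈ D′

    -- `bounded` lets comprehension over `Y` collect all values. `local` says that the clause at x
    -- consults `D` only at elements of x, which makes partial solutions unique and lets them be
    -- glued.
    module _ (bounded : ∀ {D x y} → Ψ D x y → y ∈ Y)
             (local : ∀ {D D′ x y} → AgreeBelow x D D′ → Ψ D x y → Ψ D′ x y) where

      AgreeBelow-sym : ∀ {x D D′} → AgreeBelow x D D′ → AgreeBelow x D′ D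
      AgreeBelow-sym a z y z∈x = ⇔-sym (a z y z∈x)

      good-unique : ∀ {x D D′} → Transitive x → Good D x → Good D′ x → AgreeBelow x D D′
      good-unique {x} {D} {D′} trx g g′ z y z∈x =
        ∈-induction (∀' (⟨ 1F , 0F ⟩∈' 2F ⇔' ⟨ 1F , 0F ⟩∈' 3F)) (D ∷ D′ ∷ []) x
          (λ z z∈x ih y →
             let below : AgreeBelow z D D′
                 below w y w∈z = ih w (trx z z∈x w w∈z) w∈z y
             in mk⇔ (from (g′ z y z∈x) ∘ local below ∘ to (g z y z∈x))
                    (from (g z y z∈x) ∘ local (AgreeBelow-sym below) ∘ to (g′ z y z∈x)))
          z z∈x y

      -- y enters the section at z when some solution `D′` below z satisfies the clause. By
      -- `good-unique` such solutions agree below z, so none has to be chosen.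
      good-step : ∀ {x} → IsOrdinal x → (∀ z → z ∈ x → ∃[ D ] Good D z) →
                  ∃[ D ] Good D x × (∀ z y → ⟨ z , y ⟩∈ D → z ∈ x)
      good-step {x} (trx , tr , _) ih = D , good , λ z y zy → proj₁ (to (D≐ z y) zy)
        where
        comp = comprehension
          (∃' (Good' 0F 2F (3 ↑ʳ_) ∧' rename (extend₃ 0F 2F 1F (3 ↑ʳ_)) φ)) ρ x Y
        D = proj₁ comp
        D≐ : ∀ z y → ⟨ z , y ⟩∈ D ⇔ (z ∈ x × ∃[ D′ ] (Good D′ z × Ψ D′ z y))
        D≐ z y = mk⇔
          (λ zy → let z∈x , _ , D′ , g , ψ = to (proj₂ (proj₂ comp) z y) zy in
             z∈x , D′ , to (good⇔ D′) g , to (ψ⇔ D′) ψ)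
          (λ (z∈x , D′ , g , ψ) → from (proj₂ (proj₂ comp) z y)
             (z∈x , bounded ψ , D′ , from (good⇔ D′) g , from (ψ⇔ D′) ψ))
          where
          good⇔ = λ D′ → ⊨-Good (D′ ∷ y ∷ z ∷ ρ) 0F 2F (3 ↑ʳ_) λ _ → refl
          ψ⇔ = λ D′ → ⊨-Ψ (D′ ∷ y ∷ z ∷ ρ) 0F 2F 1F (3 ↑ʳ_) λ _ → refl
        agrees : ∀ {z D′} → z ∈ x → Good D′ z → AgreeBelow z D D′
        agrees {z} {D′} z∈x g w y w∈z = mk⇔
          (λ wy → let _ , D″ , g″ , ψ = to (D≐ w y) wy in
             from (g w y w∈z) (local (good-unique (tr w w∈x) g″ gw) ψ))
          (λ wy → from (D≐ w y) (w∈x , D′ , gw , to (g w y w∈z) wy))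
          where
          w∈x = trx z z∈x w w∈z
          gw : Good D′ w
          gw v y v∈w = g v y (tr z z∈x w w∈z v v∈w)
        good : Good D x
        good z y z∈x = mk⇔
          (λ zy → let _ , D′ , g , ψ = to (D≐ z y) zy in
             local (AgreeBelow-sym (agrees z∈x g)) ψ)
          (λ ψ → let D′ , g = ih z z∈x in
             from (D≐ z y) (z∈x , D′ , g , local (agrees z∈x g) ψ))

      abstract
        -- ∈-induction with `good-step` gives a solution below every z ∈ Θ; one further `good-step`
        -- glues these together.
        recursion : ∀ {Θ} → IsOrdinal Θ →
                    ∃[ D ] (∀ x y → ⟨ x , y ⟩∈ D ⇔ (x ∈ Θ × Ψ D x y))
        recursion {Θ} oΘ =
          let D , good , dom = good-step oΘ λ z z∈Θ →
                let D , g = ∈-induction (∃' Good' 0F 1F (2 ↑ʳ_)) ρ Θ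
                      (λ x x∈Θ ih →
                         let D , g , _ = good-step (IsOrdinal-∈ oΘ x∈Θ) λ z z∈x →
                               let D , g = ih z (proj₁ oΘ x x∈Θ z z∈x) z∈x in
                               D , to (⊨-Good (D ∷ z ∷ ρ) 0F 1F (2 ↑ʳ_) λ _ → refl) g
                         in D , from (⊨-Good (D ∷ x ∷ ρ) 0F 1F (2 ↑ʳ_) λ _ → refl) g) z z∈Θ
                in D , to (⊨-Good (D ∷ z ∷ ρ) 0F 1F (2 ↑ʳ_) λ _ → refl) g
          in D , λ x y → mk⇔ (λ xy → dom x y xy , to (good x y (dom x y xy)) xy)
                             (λ (x∈Θ , ψ) → from (good x y x∈Θ) ψ)

  -- Colours of pairs under a fixed colouring of Θ.

  module Colouring (κ μ Θ c : V) (oκ : IsOrdinal κ) (oΘ : IsOrdinal Θ)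
                   (c-function : Function c (_∈[ Θ ]²) (_∈ μ)) where

    private
      trΘ = proj₁ oΘ
      cmpΘ = proj₂ (proj₂ oΘ)

    Col : V → V → V → Set ℓ
    Col γ α i = ∃[ p ] p ≐[ γ , α ] × ⟨ p , i ⟩∈ c

    Agree : V → V → V → Set ℓ
    Agree γ β α = ∃[ i ] Col γ β i × Col γ α i

    Col-unique : ∀ {γ α i j} → Col γ α i → Col γ α j → i ≡ j
    Col-unique (p , p≐ , pi) (q , q≐ , qj) with refl ← ≐[]-unique p≐ q≐ =
      proj₂ (proj₂ c-function) p _ _ pi qj

    Col-∈ : ∀ {γ α i} → Col γ α i → i ∈ μ
    Col-∈ (p , _ , q , q≐ , q∈c) with proj₁ c-function q q∈c
    ... | _ , j , _ , j∈μ , q≐′ with refl , refl ← ≐⟨⟩-injective q≐ q≐′ = j∈μ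

    Col-total : ∀ {γ α} → γ ∈ α → α ∈ Θ → ∃[ i ] Col γ α i
    Col-total {γ} {α} γ∈α α∈Θ =
      let p , p≐ = pairing γ α
          i , pi = proj₁ (proj₂ c-function) p
            (γ , α , trΘ α α∈Θ γ γ∈α , α∈Θ , (λ { refl → ∈-irrefl γ γ∈α }) , p≐)
      in i , p , p≐ , pi

    Col-Agree : ∀ {γ β α i} → Agree γ β α → Col γ α i → Col γ β i
    Col-Agree {γ} {β} (j , colβ , colα) col = subst (Col γ β) (Col-unique colα col) colβ

    Agree-sym : ∀ {γ β α} → Agree γ β α → Agree γ α β
    Agree-sym (i , colβ , colα) = i , colα , colβ

    -- The Erdős–Rado tree

    -- Pairs in `T` list the upper point first because the recursion runs along the first argument:
    -- `⟨ β , γ ⟩∈ T` is to mean γ ◁ β.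
    Predecessor : V → V → V → Set ℓ
    Predecessor T α β = β ∈ α × β ∈ Θ × (∀ γ → ⟨ β , γ ⟩∈ T → Agree γ β α)

    abstract
      tree : ∃[ T ] (∀ α β → ⟨ α , β ⟩∈ T ⇔ (α ∈ Θ × Predecessor T α β))
      tree = Recursion.recursion
        (2F ∈' 1F ∧' 2F ∈' 4F ∧' (∀' (⟨ 3F , 0F ⟩∈' 1F ⇒' Agree' 4F 0F 3F 2F)))
        (c ∷ Θ ∷ []) Θ
        (proj₁ ∘ proj₂)
        (λ below (β∈α , β∈Θ , a) → β∈α , β∈Θ , λ γ βγ → a γ (from (below _ γ β∈α) βγ))
        oΘ

    T : V
    T = proj₁ tree

    infix 4 _◁_
    _◁_ : V → V → Set ℓ
    β ◁ α = ⟨ α , β ⟩∈ T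

    ◁⇒∈ : ∀ {β α} → β ◁ α → β ∈ α
    ◁⇒∈ {β} {α} b = proj₁ (proj₂ (to (proj₂ tree α β) b))

    ◁⇒∈Θ : ∀ {β α} → β ◁ α → β ∈ Θ
    ◁⇒∈Θ {β} {α} b = proj₁ (proj₂ (proj₂ (to (proj₂ tree α β) b)))

    ◁-agree : ∀ {γ β α} → γ ◁ β → β ◁ α → Agree γ β α
    ◁-agree {γ} {β} {α} g b = proj₂ (proj₂ (proj₂ (to (proj₂ tree α β) b))) γ g

    ◁-intro : ∀ {β α} → α ∈ Θ → β ∈ α → (∀ γ → γ ◁ β → Agree γ β α) → β ◁ α
    ◁-intro {β} {α} α∈Θ β∈α a =
      from (proj₂ tree α β) (α∈Θ , β∈α , trΘ α α∈Θ β β∈α , a)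

    Agree-trans : ∀ {δ γ β α} → Agree δ γ β → Agree δ β α → Agree δ γ α
    Agree-trans (i , colγ , colβ) a = i , colγ , Col-Agree (Agree-sym a) colβ

    -- ∈-induction on α: for δ ◁ γ the induction hypothesis at β gives δ ◁ β, so c(δ , γ) = c(δ , β)
    -- = c(δ , α).
    ◁-trans : ∀ {α γ β} → α ∈ Θ → γ ◁ β → β ◁ α → γ ◁ α
    ◁-trans {α} {γ} {β} α∈Θ = ∈-induction
      (∀' ∀' (⟨ 0F , 1F ⟩∈' 3F ⇒' ⟨ 2F , 0F ⟩∈' 3F ⇒' ⟨ 2F , 1F ⟩∈' 3F)) (T ∷ []) Θ
      (λ α α∈Θ ih γ β g b →
         let β∈α = ◁⇒∈ b ; β∈Θ = ◁⇒∈Θ b in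
         ◁-intro α∈Θ (proj₁ (proj₂ oΘ) α α∈Θ β β∈α γ (◁⇒∈ g)) λ δ d →
           Agree-trans (◁-agree d g) (◁-agree (ih β β∈Θ β∈α δ γ d g) b))
      α α∈Θ γ β

    -- ∈-induction on γ: each δ ◁ γ precedes α, hence by induction β, so c(δ , γ) = c(δ , α) = c(δ ,
    -- β).
    ◁-linear : ∀ {α β γ} → α ∈ Θ → γ ◁ α → β ◁ α → γ ∈ β → γ ◁ β
    ◁-linear {α} {β} {γ} α∈Θ g b = ∈-induction
      (⟨ 2F , 0F ⟩∈' 3F ⇒' 0F ∈' 1F ⇒' ⟨ 1F , 0F ⟩∈' 3F) (β ∷ α ∷ T ∷ []) Θ
      (λ γ γ∈Θ ih g γ∈β → ◁-intro (◁⇒∈Θ b) γ∈β λ δ d →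
         Agree-trans (◁-agree d g) (Agree-sym (◁-agree
           (ih δ (◁⇒∈Θ d) (◁⇒∈ d) (◁-trans α∈Θ d g)
             (proj₁ (proj₂ oΘ) β (◁⇒∈Θ b) γ γ∈β δ (◁⇒∈ d))) b)))
      γ (◁⇒∈Θ g) g

    ◁-compare : ∀ {α β γ} → α ∈ Θ → γ ◁ α → β ◁ α → γ ◁ β ⊎ γ ≡ β ⊎ β ◁ γ
    ◁-compare α∈Θ g b =
      map (◁-linear α∈Θ g b) (map₂ (◁-linear α∈Θ b g)) (cmpΘ _ _ (◁⇒∈Θ g) (◁⇒∈Θ b))

    -- Homogeneous predecessor sets and their order types.  The i-th column of
    -- the section of S at γ is the set of ranks of the δ ◁ γ with c(δ , γ) = i,
    -- that is, the rank of γ among the points of colour i below a common bound.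

    private
      Y = proj₁ (product κ μ)
      Y≐ = proj₂ (product κ μ)

    RankIn : V → V → V → V → Set ℓ
    RankIn S γ i ξ = ∀ η → η ∈ ξ ⇔ (∃[ y ] y ≐⟨ η , i ⟩ × ⟨ γ , y ⟩∈ S)

    -- Each γ ◁ α contributes its rank in colour i paired with i, where i = c(γ , α). That rank is
    -- read off `S` at γ ∈ α, so the clause is local; `y ∈ Y` keeps only ranks in κ.
    Section : V → V → V → Set ℓ
    Section S α y = y ∈ Y × ∃[ ξ ] ∃[ i ] ∃[ γ ]
      y ≐⟨ ξ , i ⟩ × γ ◁ α × Col γ α i × RankIn S γ i ξ

    Section-local : ∀ {S S′ α y} → (∀ γ y → γ ∈ α → ⟨ γ , y ⟩∈ S ⇔ ⟨ γ , y ⟩∈ S′) →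
                    Section S α y → Section S′ α y
    Section-local below (y∈Y , ξ , i , γ , y≐ , g , col , rk) =
      y∈Y , ξ , i , γ , y≐ , g , col , λ η → mk⇔
        (λ η∈ξ → let y′ , y′≐ , e = to (rk η) η∈ξ in y′ , y′≐ , to (below γ y′ (◁⇒∈ g)) e)
        (λ (y′ , y′≐ , e) → from (rk η) (y′ , y′≐ , from (below γ y′ (◁⇒∈ g)) e))

    abstract
      sections : ∃[ S ] (∀ α y → ⟨ α , y ⟩∈ S ⇔ (α ∈ Θ × Section S α y))
      sections = Recursion.recursion
          (2F ∈' 5F ∧' (∃' ∃' ∃' (5F ≐⟨ 2F , 1F ⟩' ∧' ⟨ 4F , 0F ⟩∈' (3 ↑ʳ 4F)
             ∧' Col' 6F 0F 4F 1F ∧' Rank' 3F 0F 1F 2F)))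
          (c ∷ T ∷ Y ∷ []) Y proj₁ Section-local oΘ

    S : V
    S = proj₁ sections

    Rank : V → V → V → Set ℓ
    Rank = RankIn S

    S-intro : ∀ {α γ i ξ y} → α ∈ Θ → γ ◁ α → Col γ α i → ξ ∈ κ → Rank γ i ξ →
              y ≐⟨ ξ , i ⟩ → ⟨ α , y ⟩∈ S
    S-intro {α} {γ} {i} {ξ} {y} α∈Θ g col ξ∈κ rk y≐ = from (proj₂ sections α y)
      (α∈Θ , from (Y≐ y) (ξ , i , ξ∈κ , Col-∈ col , y≐) , ξ , i , γ , y≐ , g , col , rk)

    S-elim : ∀ {α y} → ⟨ α , y ⟩∈ S →
             ∃[ ξ ] ∃[ i ] ∃[ γ ] y ≐⟨ ξ , i ⟩ × γ ◁ α × Col γ α i × ξ ∈ κ × Rank γ i ξ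
    S-elim {α} {y} e with to (proj₂ sections α y) e
    ... | _ , y∈Y , ξ , i , γ , y≐ , g , col , rk with to (Y≐ y) y∈Y
    ...   | _ , _ , ξ∈κ , _ , y≐′ with refl , refl ← ≐⟨⟩-injective y≐ y≐′ =
      ξ , i , γ , y≐ , g , col , ξ∈κ , rk

    Rank-unique : ∀ {γ i ξ ξ′} → Rank γ i ξ → Rank γ i ξ′ → ξ ≡ ξ′
    Rank-unique rk rk′ = extensionality _ _ λ η →
      mk⇔ (from (rk′ η) ∘ to (rk η)) (from (rk η) ∘ to (rk′ η))

    Rank-intro : ∀ {α γ i ξ ζ} → α ∈ Θ → γ ◁ α → Col γ α i → ξ ∈ κ → Rank γ i ξ →
                 Rank α i ζ → ξ ∈ ζ
    Rank-intro {i = i} {ξ} α∈Θ g col ξ∈κ rk rkα =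
      let y , y≐ = ordered-pair ξ i in
      from (rkα ξ) (y , y≐ , S-intro α∈Θ g col ξ∈κ rk y≐)

    Rank-elim : ∀ {α i ζ ξ} → Rank α i ζ → ξ ∈ ζ →
                ∃[ γ ] γ ◁ α × Col γ α i × ξ ∈ κ × Rank γ i ξ
    Rank-elim {ξ = ξ} rk ξ∈ζ with to (rk ξ) ξ∈ζ
    ... | y , y≐ , e with S-elim e
    ...   | _ , _ , γ , y≐′ , g , col , ξ∈κ , rkγ with refl , refl ← ≐⟨⟩-injective y≐ y≐′ =
      γ , g , col , ξ∈κ , rkγ

    Rank-exists : ∀ α i → ∃[ ζ ] Rank α i ζ
    Rank-exists α i =
      let ζ , ζ≐ = separation (∃' (0F ≐⟨ 1F , 3F ⟩' ∧' ⟨ 2F , 0F ⟩∈' 4F)) (α ∷ i ∷ S ∷ []) κ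
      in ζ , λ η → mk⇔ (proj₂ ∘ to (ζ≐ η)) λ (y , y≐ , e) →
           from (ζ≐ η) (bound y≐ (S-elim e) , y , y≐ , e)
      where
      bound : ∀ {y η} → y ≐⟨ η , i ⟩ →
              ∃[ ξ ] ∃[ i ] ∃[ γ ] y ≐⟨ ξ , i ⟩ × γ ◁ α × Col γ α i × ξ ∈ κ × Rank γ i ξ → η ∈ κ
      bound y≐ (_ , _ , _ , y≐′ , _ , _ , ξ∈κ , _) with refl , refl ← ≐⟨⟩-injective y≐ y≐′ = ξ∈κ

    -- For α ∈ Θ the i-th column at α is a transitive subset of κ, so this fails just when the
    -- column is all of κ.
    Ranked : V → V → Set ℓ
    Ranked α i = ∃[ ξ ] ξ ∈ κ × Rank α i ξ

    AllRanked : Set ℓ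
    AllRanked = ∀ α i → α ∈ Θ → i ∈ μ → Ranked α i

    HomogeneousSet : Set ℓ
    HomogeneousSet = ∃[ H ] H ⊆ Θ × H ≃ κ × ConstantOn[ H ]² c

    Col-down : ∀ {δ γ α j} → δ ◁ γ → γ ◁ α → Col δ α j → Col δ γ j
    Col-down d g = Col-Agree (◁-agree d g)

    Col-up : ∀ {δ γ α j} → δ ◁ γ → γ ◁ α → Col δ γ j → Col δ α j
    Col-up d g = Col-Agree (Agree-sym (◁-agree d g))

    module Homogeneous {α i ζ} (α∈Θ : α ∈ Θ) (rk : Rank α i ζ) (ζ∉κ : ¬ (ζ ∈ κ))
                       (ranked : ∀ {γ} → γ ◁ α → Col γ α i → Ranked γ i) where

      -- ζ is a transitive subset of κ: elements of a rank ξ ∈ ζ are ranks of points δ ◁ γ ◁ α,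
      -- which again have colour i with α.
      ζ≡κ : ζ ≡ κ
      ζ≡κ = [ id , ⊥-elim ∘ ζ∉κ ] (transitive-subset oκ
        (λ ξ ξ∈ζ η η∈ξ →
           let γ , g , _ , _ , rkγ = Rank-elim rk ξ∈ζ
               δ , d , col , η∈κ , rkδ = Rank-elim rkγ η∈ξ
           in Rank-intro α∈Θ (◁-trans α∈Θ d g) (Col-up d g col) η∈κ rkδ rk)
        (λ ξ ξ∈ζ → let _ , _ , _ , ξ∈κ , _ = Rank-elim rk ξ∈ζ in ξ∈κ))

      abstract
        predecessors : ∃[ H ] (∀ γ → γ ∈ H ⇔ (γ ∈ Θ × γ ◁ α × Col γ α i))
        predecessors = separation (⟨ 1F , 0F ⟩∈' 2F ∧' Col' 3F 0F 1F 4F) (α ∷ T ∷ c ∷ i ∷ []) Θ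

      H : V
      H = proj₁ predecessors

      H-elim : ∀ {γ} → γ ∈ H → γ ◁ α × Col γ α i
      H-elim {γ} = proj₂ ∘ to (proj₂ predecessors γ)

      abstract
        rank-graph : ∃[ f ] (∀ p → p ∈ f → ∃[ γ ] ∃[ ξ ] γ ∈ H × ξ ∈ κ × p ≐⟨ γ , ξ ⟩)
                          × (∀ γ ξ → ⟨ γ , ξ ⟩∈ f ⇔ (γ ∈ H × ξ ∈ κ × Rank γ i ξ))
        rank-graph = comprehension (Rank' 3F 1F 2F 0F) (i ∷ S ∷ []) H κ

      private
        f = proj₁ rank-graph
        f≐ = proj₂ (proj₂ rank-graph)

      -- If γ ◁ γ′, the rank of γ is an element of that of γ′, so a common rank would be an element
      -- of itself.
      ranks-distinct : ∀ {γ γ′ ξ} → γ ∈ H → γ′ ∈ H → Rank γ i ξ → Rank γ′ i ξ → ¬ (γ ◁ γ′)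
      ranks-distinct {ξ = ξ} γ∈H γ′∈H rkγ rkγ′ g =
        let γ◁α , col = H-elim γ∈H
            γ′◁α , _ = H-elim γ′∈H
            ξ′ , ξ′∈κ , rk′ = ranked γ◁α col
        in ∈-irrefl ξ (Rank-intro (◁⇒∈Θ γ′◁α) g (Col-down g γ′◁α col)
             (subst (_∈ κ) (Rank-unique rk′ rkγ) ξ′∈κ) rkγ rkγ′)

      H≃κ : H ≃ κ
      H≃κ = f ,
        (proj₁ (proj₂ rank-graph) ,
         (λ γ γ∈H → let γ◁α , col = H-elim γ∈H
                        ξ , ξ∈κ , rkγ = ranked γ◁α col
                    in ξ , from (f≐ γ ξ) (γ∈H , ξ∈κ , rkγ)) ,
         (λ γ ξ ξ′ e e′ → let _ , _ , rkγ = to (f≐ γ ξ) e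
                              _ , _ , rkγ′ = to (f≐ γ ξ′) e′
                          in Rank-unique rkγ rkγ′)) ,
        (λ γ γ′ ξ e e′ →
           let γ∈H , _ , rkγ = to (f≐ γ ξ) e
               γ′∈H , _ , rkγ′ = to (f≐ γ′ ξ) e′
           in [ (λ g → ⊥-elim (ranks-distinct γ∈H γ′∈H rkγ rkγ′ g))
              , [ id , (λ g → ⊥-elim (ranks-distinct γ′∈H γ∈H rkγ′ rkγ g)) ] ]
              (◁-compare α∈Θ (proj₁ (H-elim γ∈H)) (proj₁ (H-elim γ′∈H)))) ,
        -- Surjectivity is where ζ = κ enters: each element of ζ is the rank of a predecessor of
        -- colour i.
        λ ξ ξ∈κ →
          let γ , g , col , _ , rkγ = Rank-elim rk (subst (ξ ∈_) (sym ζ≡κ) ξ∈κ)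
          in γ , from (f≐ γ ξ) (from (proj₂ predecessors γ) (◁⇒∈Θ g , g , col) , ξ∈κ , rkγ)

      -- Of two points of `H` one precedes the other, and its colour with the upper one is its
      -- colour with α, namely i.
      colour-i : ∀ {p u} → p ∈[ H ]² → ⟨ p , u ⟩∈ c → u ≡ i
      colour-i {p} {u} (a , b , a∈H , b∈H , a≢b , p≐) pu =
        let a◁α , cola = H-elim a∈H
            b◁α , colb = H-elim b∈H
        in [ (λ a◁b → Col-unique (p , p≐ , pu) (Col-down a◁b b◁α cola))
           , [ (λ e → ⊥-elim (a≢b e))
             , (λ b◁a → Col-unique (p , ≐[]-comm p≐ , pu) (Col-down b◁a a◁α colb)) ] ]
           (◁-compare α∈Θ a◁α b◁α)

      homogeneous : HomogeneousSet
      homogeneous = H , (λ γ γ∈H → ◁⇒∈Θ (proj₁ (H-elim γ∈H))) , H≃κ ,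
        λ p q u v p∈ q∈ pu qv → trans (colour-i p∈ pu) (sym (colour-i q∈ qv))

    homogeneous-or-ranked : HomogeneousSet ⊎ AllRanked
    homogeneous-or-ranked = decide (classical
      (∃' (0F ∈' 1F ∧' unranked)) (Θ ∷ μ ∷ κ ∷ S ∷ []))
      where
      unranked : Formula 5
      unranked = ∃' (0F ∈' 3F ∧' (¬' (∃' (0F ∈' 5F ∧' Rank' 6F 2F 1F 0F))))
      ranked? : ∀ α i → Dec (Ranked α i)
      ranked? α i = classical (∃' (0F ∈' 3F ∧' Rank' 4F 1F 2F 0F)) (α ∷ i ∷ κ ∷ S ∷ [])
      decide : Dec (∃[ α ] α ∈ Θ × ∃[ i ] i ∈ μ × ¬ Ranked α i) →
               HomogeneousSet ⊎ AllRanked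
      decide (no none) = inj₂ λ α i α∈Θ i∈μ → decidable-stable (ranked? α i)
        λ ¬r → none (α , α∈Θ , i , i∈μ , ¬r)
      decide (yes some) =
        -- Minimality of α leaves each γ ◁ α ranked in every colour, as `Homogeneous` requires.
        let α , α∈Θ , (i , i∈μ , ¬r) , min = least unranked (Θ ∷ μ ∷ κ ∷ S ∷ []) Θ some
            ζ , rk = Rank-exists α i
        in inj₁ (Homogeneous.homogeneous α∈Θ rk (λ ζ∈κ → ¬r (ζ , ζ∈κ , rk))
             λ {γ} g col → decidable-stable (ranked? γ i)
               λ ¬rγ → min γ (◁⇒∈Θ g) (i , i∈μ , ¬rγ) (◁⇒∈ g))

    -- Without a homogeneous set, α is recovered from the set of pairs
    -- ⟨ section of S at γ , c(γ , α) ⟩ for γ ◁ α: the sections increase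
    -- strictly along ◁, so they determine the position of γ in the branch.

    module Coding (ranked : AllRanked) where

      Same : V → V → Set ℓ
      Same γ γ′ = ∀ y → ⟨ γ , y ⟩∈ S ⇔ ⟨ γ′ , y ⟩∈ S

      -- Inclusion of the code of α in that of α′, expressed through points with equal sections.
      Sub : V → V → Set ℓ
      Sub α α′ = ∀ γ i → γ ◁ α → Col γ α i → ∃[ γ′ ] γ′ ◁ α′ × Col γ′ α′ i × Same γ γ′

      section-mono : ∀ {γ α y} → α ∈ Θ → γ ◁ α → ⟨ γ , y ⟩∈ S → ⟨ α , y ⟩∈ S
      section-mono α∈Θ g e =
        let _ , _ , _ , y≐ , d , col , ξ∈κ , rk = S-elim e
        in S-intro α∈Θ (◁-trans α∈Θ d g) (Col-up d g col) ξ∈κ rk y≐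

      -- With i = c(γ , α) and ξ the rank of γ in colour i, the pair ⟨ ξ , i ⟩ is in the section at
      -- α. In the section at γ it would give ξ ∈ ξ.
      section-strict : ∀ {γ α} → α ∈ Θ → γ ◁ α → ¬ (∀ y → ⟨ α , y ⟩∈ S → ⟨ γ , y ⟩∈ S)
      section-strict α∈Θ g α⊆γ =
        let i , col = Col-total (◁⇒∈ g) α∈Θ
            ξ , ξ∈κ , rk = ranked _ i (◁⇒∈Θ g) (Col-∈ col)
            y , y≐ = ordered-pair ξ i
        in ∈-irrefl ξ (from (rk ξ) (y , y≐ , α⊆γ y (S-intro α∈Θ g col ξ∈κ rk y≐)))

      -- δ ◁ γ is matched with some δ′ ◁ α′. If δ′ did not precede γ′, the section at γ′ would be
      -- contained in that at δ′, hence that at γ in that at δ, against `section-strict`.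
      Sub-restrict : ∀ {α α′ γ γ′} → α ∈ Θ → α′ ∈ Θ → Sub α α′ →
                     γ ◁ α → γ′ ◁ α′ → Same γ γ′ → Sub γ γ′
      Sub-restrict {α′ = α′} {γ} {γ′} α∈Θ α′∈Θ sub g g′ same δ j d col =
        let δ′ , d′ , col′ , same′ = sub δ j (◁-trans α∈Θ d g) (Col-up d g col)
            below = position d′ same′
        in δ′ , below , Col-down below g′ col′ , same′
        where
        strict : ∀ {δ′} → Same δ δ′ → ¬ (∀ y → ⟨ γ′ , y ⟩∈ S → ⟨ δ′ , y ⟩∈ S)
        strict same′ γ′⊆δ′ = section-strict (◁⇒∈Θ g) d
          λ y → from (same′ y) ∘ γ′⊆δ′ y ∘ to (same y)
        position : ∀ {δ′} → δ′ ◁ α′ → Same δ δ′ → δ′ ◁ γ′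
        position d′ same′ =
          [ id , [ (λ { refl → ⊥-elim (strict same′ λ _ → id) })
                 , (λ above → ⊥-elim (strict same′ λ _ → section-mono (◁⇒∈Θ d′) above)) ] ]
            (◁-compare α′∈Θ d′ g′)

      -- Matched points of the two branches satisfy `Sub` in both directions by `Sub-restrict`, so
      -- the induction hypothesis identifies them.
      same-predecessors : ∀ {α α′} → α ∈ Θ → α′ ∈ Θ → Sub α α′ → Sub α′ α →
        (∀ γ → γ ◁ α → ∀ γ′ → γ′ ∈ Θ → Sub γ γ′ → Sub γ′ γ → γ ≡ γ′) →
        ∀ γ i → (γ ◁ α × Col γ α i) ⇔ (γ ◁ α′ × Col γ α′ i)
      same-predecessors {α} {α′} α∈Θ α′∈Θ sub sub′ ih γ i = mk⇔
        (λ (g , col) → fwd g (sub γ i g col)) (λ (g , col) → bwd g (sub′ γ i g col))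
        where
        equal : ∀ {γ γ′} → γ ◁ α → γ′ ◁ α′ → Same γ γ′ → γ ≡ γ′
        equal g g′ same = ih _ g _ (◁⇒∈Θ g′) (Sub-restrict α∈Θ α′∈Θ sub g g′ same)
          (Sub-restrict α′∈Θ α∈Θ sub′ g′ g λ y → ⇔-sym (same y))
        fwd : ∀ {γ} → γ ◁ α → ∃[ γ′ ] γ′ ◁ α′ × Col γ′ α′ i × Same γ γ′ → γ ◁ α′ × Col γ α′ i
        fwd g (γ′ , g′ , col′ , same) =
          subst (λ γ → γ ◁ α′ × Col γ α′ i) (sym (equal g g′ same)) (g′ , col′)
        bwd : ∀ {γ} → γ ◁ α′ → ∃[ γ′ ] γ′ ◁ α × Col γ′ α i × Same γ γ′ → γ ◁ α × Col γ α i
        bwd g (γ′ , g′ , col′ , same) =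
          subst (λ γ → γ ◁ α × Col γ α i) (equal g′ g λ y → ⇔-sym (same y)) (g′ , col′)

      -- If α ∈ α′, equal colours on the common predecessors give α ◁ α′; then α would be among its
      -- own predecessors.
      predecessors-∉ : ∀ {α α′} → α′ ∈ Θ →
        (∀ γ i → (γ ◁ α × Col γ α i) ⇔ (γ ◁ α′ × Col γ α′ i)) → ¬ (α ∈ α′)
      predecessors-∉ {α} {α′} α′∈Θ same α∈α′ =
        ∈-irrefl α (◁⇒∈ (proj₁ (from (same α j) (α◁α′ , proj₂ col))))
        where
        α∈Θ = trΘ α′ α′∈Θ α α∈α′
        α◁α′ : α ◁ α′
        α◁α′ = ◁-intro α′∈Θ α∈α′ λ γ g →
          let i , col = Col-total (◁⇒∈ g) α∈Θ in i , col , proj₂ (to (same γ i) (g , col))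
        col = Col-total α∈α′ α′∈Θ
        j = proj₁ col

      -- By ∈-induction on α the two points have the same predecessors with the same colours, so
      -- neither is an element of the other.
      Sub-antisym : ∀ α → α ∈ Θ → ∀ α′ → α′ ∈ Θ → Sub α α′ → Sub α′ α → α ≡ α′
      Sub-antisym = ∈-induction
        (∀' (0F ∈' 2F ⇒' Sub' 3F 4F 5F 1F 0F ⇒' Sub' 3F 4F 5F 0F 1F ⇒' 1F ≡' 0F))
        (Θ ∷ c ∷ T ∷ S ∷ []) Θ
        λ α α∈Θ ih α′ α′∈Θ sub sub′ →
          let same = same-predecessors α∈Θ α′∈Θ sub sub′ (λ γ g → ih γ (◁⇒∈Θ g) (◁⇒∈ g))
          in [ (λ e → ⊥-elim (predecessors-∉ α′∈Θ same e))
             , [ id , (λ e → ⊥-elim (predecessors-∉ α∈Θ (λ γ i → ⇔-sym (same γ i)) e)) ] ]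
             (cmpΘ α α′ α∈Θ α′∈Θ)

      SectionSet : V → V → Set ℓ
      SectionSet z γ = ∀ y → y ∈ z ⇔ ⟨ γ , y ⟩∈ S

      Code : V → V → Set ℓ
      Code u α = ∀ z i → ⟨ z , i ⟩∈ u ⇔ (∃[ γ ] γ ◁ α × Col γ α i × SectionSet z γ)

      section-set : ∀ γ → ∃[ z ] SectionSet z γ
      section-set γ =
        let z , z≐ = separation (⟨ 1F , 0F ⟩∈' 2F) (γ ∷ S ∷ []) Y
        in z , λ y → mk⇔ (proj₂ ∘ to (z≐ y))
             λ e → from (z≐ y) (proj₁ (proj₂ (to (proj₂ sections γ y) e)) , e)

      Code⇒Sub : ∀ {u α α′} → Code u α → Code u α′ → Sub α α′
      Code⇒Sub code code′ γ i g col =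
        let z , z≐ = section-set γ
            γ′ , g′ , col′ , z≐′ = to (code′ z i) (from (code z i) (γ , g , col , z≐))
        in γ′ , g′ , col′ , λ y → mk⇔ (to (z≐′ y) ∘ from (z≐ y)) (to (z≐ y) ∘ from (z≐′ y))

      Codes : V
      Codes = proj₁ (powerset (proj₁ (product (proj₁ (powerset Y)) μ)))

      code : ∀ α → ∃[ u ] u ∈ Codes × Code u α
      code α =
        let u , pairs , u≐ = comprehension
              (∃' (⟨ 3F , 0F ⟩∈' 4F ∧' Col' 5F 0F 3F 1F
                   ∧' (∀' (0F ∈' 3F ⇔' ⟨ 1F , 0F ⟩∈' (3 ↑ʳ 4F)))))
              (α ∷ T ∷ c ∷ S ∷ []) (proj₁ (powerset Y)) μ
        in u , from (proj₂ (powerset _) u) (λ p → from (proj₂ (product _ _) p) ∘ pairs p) ,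
           λ z i → mk⇔ (proj₂ ∘ proj₂ ∘ to (u≐ z i)) λ (γ , g , col , z≐) →
             from (u≐ z i)
               (from (proj₂ (powerset Y) z) (λ y y∈z →
                  proj₁ (proj₂ (to (proj₂ sections γ y) (to (z≐ y) y∈z)))) ,
                Col-∈ col , γ , g , col , z≐)

      Θ-embeds : Θ embeds-in Codes
      Θ-embeds =
        let h , _ , h≐ = comprehension
              (∀' ∀' (⟨ 1F , 0F ⟩∈' 2F ⇔'
                (∃' (⟨ 4F , 0F ⟩∈' 5F ∧' Col' 6F 0F 4F 1F
                     ∧' (∀' (0F ∈' 3F ⇔' ⟨ 1F , 0F ⟩∈' (4 ↑ʳ 4F)))))))
              (T ∷ c ∷ S ∷ []) Θ Codes
        in h , (λ α α∈Θ → let u , u∈ , cd = code α in u , u∈ , from (h≐ α u) (α∈Θ , u∈ , cd)) ,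
           λ α α′ u e e′ →
             let α∈Θ , _ , cd = to (h≐ α u) e
                 α′∈Θ , _ , cd′ = to (h≐ α′ u) e′
             in Sub-antisym α α∈Θ α′ α′∈Θ (Code⇒Sub cd cd′) (Code⇒Sub cd′ cd)

theorem3p2 : {ℓ : Level} (𝔐 : Structure ℓ) →
    Satisfaction.Classical 𝔐 → ZF 𝔐 →
    let open SetTheory 𝔐 in
    (κ μ : Carrier) → Cardinal κ → Ordinal μ →
    ∃[ θ ] Cardinal θ × (θ ⟶⟨ κ ⟩² μ)
theorem3p2 𝔐 classical zf κ μ (oκ , _) _ =
  let Y = proj₁ (product κ μ)
      -- The same set as `Coding.Codes`. It depends on κ and μ alone, so its Hartogs number can be
      -- fixed before the colouring is given.
      Codes = proj₁ (powerset (proj₁ (product (proj₁ (powerset Y)) μ)))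
      Θ , cardΘ , Θ⋠Codes = hartogs Codes
  in Θ , cardΘ , λ c c-function →
       let open Colouring κ μ Θ c (Ordinal⇒IsOrdinal oκ) (Ordinal⇒IsOrdinal (proj₁ cardΘ)) c-function
       in [ id , (λ ranked → ⊥-elim (Θ⋠Codes (Coding.Θ-embeds ranked))) ] homogeneous-or-ranked
  where
  open ZF zf
  open Development 𝔐 classical zf
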